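{- Let $R\subseteq\mathbb{Z}^{\mathbf{x}}\times\mathbb{Z}^{\mathbf{x}}$ be a relation such that at least one of the following holds: (1) $\bigcap_{n\ge1}\mathrm{pre}_R^n(\mathbb{Z}^{\mathbf{x}})=\emptyset$; (2) $\mathrm{pre}_R^{n_2}(\mathbb{Z}^{\mathbf{x}})=\mathrm{pre}_R^{n_1}(\mathbb{Z}^{\mathbf{x}})$ for some $n_2>n_1\ge1$; (3) $\mathrm{pre}_R$ is $\cap$-continuous. Then $\mathrm{wrs}(R)=\bigcap_{n\ge1}\mathrm{pre}_R^n(\mathbb{Z}^{\mathbf{x}})$. Moreover, $\mathrm{wrs}(R)=\emptyset$ if (1) holds, and $\mathrm{wrs}(R)=\mathrm{pre}_R^{n_1}(\mathbb{Z}^{\mathbf{x}})$ if (2) holds.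
   Context: $\mathbf{x}=\{x_1,\dots,x_N\}$, $N>0$, is a set of integer variables and $\mathbb{Z}^{\mathbf{x}}$ the set of valuations $\mathbf{x}\to\mathbb{Z}$. For $S\subseteq\mathbb{Z}^{\mathbf{x}}$, $\mathrm{pre}_R(S)=\{\nu\mid\exists\nu'\in S.\ (\nu,\nu')\in R\}$, and $\mathrm{pre}_R^n$ is its $n$-fold iterate. A function $F:2^{\mathbb{Z}^{\mathbf{x}}}\to2^{\mathbb{Z}^{\mathbf{x}}}$ is $\cap$-continuous if $F(\bigcap_{i\ge1}S_i)=\bigcap_{i\ge1}F(S_i)$ for every infinite sequence $\{S_i\}_{i\ge1}$ of subsets of $\mathbb{Z}^{\mathbf{x}}$. A set $S\subseteq\mathbb{Z}^{\mathbf{x}}$ is recurrent for $R$ if $S\subseteq\mathrm{pre}_R(S)$; $\mathrm{wrs}(R)$ (weakest recurrent set) is the union of all recurrent sets for $R$. -}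

module Defs where

open import Level using (Level)
open import Data.Integer.Base using (ℤ)
open import Data.Nat.Base using (ℕ; _≥_)
open import Data.Nat.GeneralisedArithmetic using (fold)
open import Data.Product.Base using (∃; ∃-syntax; _×_; proj₁)
open import Data.Vec.Base using (Vec)
open import Function.Base using (_∘_)
open import Relation.Binary.Core using (Rel)
open import Relation.Unary using (Pred; _∈_; _⊆_; _≐_; ⋂; ⋃)

private
  variable
    ℓ : Level
    N : ℕ

-- Valuations of x₁ , … , x_N.  Tuples are used instead of functions
-- Fin N → ℤ so that valuations agreeing on every variable are
-- propositionally equal, and hence every Pred is a set of valuations.
Valuation : ℕ → Set
Valuation N = Vec ℤ N

pre : Rel (Valuation N) ℓ → Pred (Valuation N) ℓ → Pred (Valuation N) ℓ
pre R S ν = ∃[ ν′ ] (ν′ ∈ S × R ν ν′)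

pre^ : Rel (Valuation N) ℓ → ℕ → Pred (Valuation N) ℓ → Pred (Valuation N) ℓ
pre^ R n S = fold S (pre R) n

-- The family is indexed by n ≥ 1; the member at 0 is ignored.
⋂≥1 : (ℕ → Pred (Valuation N) ℓ) → Pred (Valuation N) ℓ
⋂≥1 S = ⋂ (∃[ n ] n ≥ 1) (S ∘ proj₁)

⋂-Continuous : (Pred (Valuation N) ℓ → Pred (Valuation N) ℓ) → Set _
⋂-Continuous {N} {ℓ} F =
  (S : ℕ → Pred (Valuation N) ℓ) → F (⋂≥1 S) ≐ ⋂≥1 (λ i → F (S i))

Recurrent : Rel (Valuation N) ℓ → Pred (Valuation N) ℓ → Set _
Recurrent R S = S ⊆ pre R S

-- This union ranges over all sets at the level ℓ of R, so predicatively it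
-- lives one universe higher; _≐_ compares predicates of different levels.
wrs : Rel (Valuation N) ℓ → Pred (Valuation N) _
wrs R = ⋃ (∃ (Recurrent R)) proj₁

{-# OPTIONS --safe #-}

-- By monotonicity of pre, a recurrent set lies in every pre^ R n U, so
-- wrs R ⊆ ⋂ₙ pre^ R n U always holds.  For the converse it suffices that
-- the intersection, or some set containing it, is recurrent.  Under (2) the
-- decreasing chain is stationary from n₁ on, so pre^ R n₁ U is recurrent;
-- under (3) continuity along the chain itself makes the intersection so.
module Submission where

open import Defs
open import Level using (Level; lift)
open import Data.Empty using (⊥-elim)
open import Data.Nat.Base using (ℕ; zero; suc; z≤n; s≤s; _≤_; NonZero; _<_; _≥_)
open import Data.Product.Base using (_×_; ∃-syntax; _,_; proj₁; proj₂)
open import Data.Sum.Base using (_⊎_; inj₁; inj₂)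
open import Data.Unit.Base using (tt)
open import Relation.Binary.Core using (Rel)
open import Relation.Unary using (Pred; _⊆_; _≐_; ∅)
open import Relation.Unary.Polymorphic using (U)

module _ {ℓ : Level} {N : ℕ} (R : Rel (Valuation N) ℓ) where

  pre-mono : {S T : Pred (Valuation N) ℓ} → S ⊆ T → pre R S ⊆ pre R T
  pre-mono S⊆T (ν′ , ν′∈S , νRν′) = ν′ , S⊆T ν′∈S , νRν′

  -- The iteration starts at the full set, and monotonicity carries each inclusion one step on.
  pre^-antitone : ∀ {m n} → m ≤ n → pre^ R n U ⊆ pre^ R m U
  pre^-antitone z≤n       _ = lift tt
  pre^-antitone (s≤s m≤n)   = pre-mono (pre^-antitone m≤n)

  recurrent⊆pre^ : {S : Pred (Valuation N) ℓ} → Recurrent R S → ∀ n → S ⊆ pre^ R n U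
  recurrent⊆pre^ rec zero    _   = lift tt
  recurrent⊆pre^ rec (suc n) ν∈S = pre-mono (recurrent⊆pre^ rec n) (rec ν∈S)

  recurrent⊆wrs : {S : Pred (Valuation N) ℓ} → Recurrent R S → S ⊆ wrs R
  recurrent⊆wrs {S} rec ν∈S = (S , rec) , ν∈S

  wrs⊆pre^ : ∀ n → wrs R ⊆ pre^ R n U
  wrs⊆pre^ n ((S , rec) , ν∈S) = recurrent⊆pre^ rec n ν∈S

  wrs⊆⋂pre^ : wrs R ⊆ ⋂≥1 (λ n → pre^ R n U)
  wrs⊆⋂pre^ ν∈wrs (n , _) = wrs⊆pre^ n ν∈wrs

  -- Since `m < n` is `suc m ≤ n`, antitonicity puts `pre^ R n U` inside `pre^ R (suc m) U`, which
  -- is `pre R (pre^ R m U)` by definition.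
  stationary⇒recurrent : ∀ {m n} → m < n → pre^ R m U ⊆ pre^ R n U →
                         Recurrent R (pre^ R m U)
  stationary⇒recurrent m<n m⊆n ν∈m = pre^-antitone m<n (m⊆n ν∈m)

  continuous⇒⋂pre^-recurrent : ⋂-Continuous (pre R) →
                               Recurrent R (⋂≥1 (λ n → pre^ R n U))
  continuous⇒⋂pre^-recurrent cont ν∈⋂ =
    -- Index shift: `pre R (pre^ R n U)` is the member at `suc n` of the same intersection.
    proj₂ (cont (λ n → pre^ R n U)) λ (n , _) → ν∈⋂ (suc n , s≤s z≤n)

lemma3p7 : ∀ {ℓ : Level} (N : ℕ) .{{_ : NonZero N}} (R : Rel (Valuation N) ℓ) →
    ( (⋂≥1 (λ n → pre^ R n U) ≐ ∅)
    ⊎ (∃[ n₁ ] ∃[ n₂ ] (n₁ ≥ 1 × n₁ < n₂ × pre^ R n₂ U ≐ pre^ R n₁ U))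
    ⊎ ⋂-Continuous (pre R) ) →
    (wrs R ≐ ⋂≥1 (λ n → pre^ R n U))
    × (⋂≥1 (λ n → pre^ R n U) ≐ ∅ → wrs R ≐ ∅)
    × (∀ n₁ n₂ → n₁ ≥ 1 → n₁ < n₂ → pre^ R n₂ U ≐ pre^ R n₁ U →
        wrs R ≐ pre^ R n₁ U)
lemma3p7 N R hyp =
    (wrs⊆⋂pre^ R , ⋂pre^⊆wrs hyp)
  , (λ ⋂≐∅ → (λ ν∈wrs → proj₁ ⋂≐∅ (wrs⊆⋂pre^ R ν∈wrs)) , λ ())
  , λ n₁ n₂ _ n₁<n₂ eq →
      wrs⊆pre^ R n₁ , recurrent⊆wrs R (stationary⇒recurrent R n₁<n₂ (proj₂ eq))
  where
  ⋂pre^⊆wrs :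
    ( (⋂≥1 (λ n → pre^ R n U) ≐ ∅)
    ⊎ (∃[ n₁ ] ∃[ n₂ ] (n₁ ≥ 1 × n₁ < n₂ × pre^ R n₂ U ≐ pre^ R n₁ U))
    ⊎ ⋂-Continuous (pre R) ) →
    ⋂≥1 (λ n → pre^ R n U) ⊆ wrs R
  ⋂pre^⊆wrs (inj₁ ⋂≐∅) ν∈⋂ = ⊥-elim (proj₁ ⋂≐∅ ν∈⋂)
  ⋂pre^⊆wrs (inj₂ (inj₁ (n₁ , n₂ , n₁≥1 , n₁<n₂ , eq))) ν∈⋂ =
    -- As `n₁ ≥ 1`, the recurrent set `pre^ R n₁ U` is itself a member of the intersection.
    recurrent⊆wrs R (stationary⇒recurrent R n₁<n₂ (proj₂ eq)) (ν∈⋂ (n₁ , n₁≥1))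
  ⋂pre^⊆wrs (inj₂ (inj₂ cont)) =
    recurrent⊆wrs R (continuous⇒⋂pre^-recurrent R cont)
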